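{- Let $X_n$ be a finite Dynkin diagram (one of $A_n,B_n,C_n,D_n,E_6,E_7,E_8,F_4,G_2$) with poset of positive roots $(\Phi_+,\le)$. The set $(u_p)_p$, where $p$ runs over all antichains of $(\Phi_+,\le)$, is a basis (over $\mathbb{Z}$) of the ring $U_{X_n}$.
   Context: $\Phi_+$ is the set of positive roots of the (irreducible, reduced, crystallographic) root system of type $X_n$, with the partial order $\alpha\le\beta$ iff $\beta-\alpha$ has non-negative coefficients in the basis of simple roots. An antichain is a (possibly empty) set of pairwise incomparable elements of $\Phi_+$. $U_{X_n}$ is the commutative unital ring (over $\mathbb{Z}$) generated by variables $u_\alpha$, $\alpha\in\Phi_+$, modulo the relations $u_\alpha u_\beta=u_{\min(\alpha,\beta)}$ for all $\alpha,\beta\in\Phi_+$ that are comparable for $\le$ (including $\alpha=\beta$, i.e. $u_\alpha^2=u_\alpha$). For an antichain $p=\{\alpha_1,\dots,\alpha_k\}$, $u_p=u_{\alpha_1}\cdots u_{\alpha_k}\in U_{X_n}$ (with $u_\emptyset=1$). -}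

module Defs where

open import Algebra.Bundles using (AbelianGroup; CommutativeRing)
import Algebra.Definitions.RawMonoid as RawMonoidDefinitions
open import Data.Fin.Base using (Fin; toℕ)
open import Data.Integer.Base as ℤ using (ℤ; +_; -[1+_]; 0ℤ; 1ℤ)
open import Data.List.Base using (List; []; _∷_; _++_; foldr; map; upTo)
open import Data.List.Relation.Binary.Permutation.Propositional using (↭-setoid; ↭⇒↭ₛ′)
open import Data.List.Relation.Binary.Permutation.Propositional.Properties using (map⁺)
import Data.List.Relation.Binary.Permutation.Setoid.Properties as SetoidPerm
open import Data.List.Relation.Unary.All using (All)
open import Data.List.Relation.Unary.AllPairs using (AllPairs)
open import Data.Nat.Base as ℕ using (ℕ; suc; _∸_; _≡ᵇ_)
open import Data.Bool.Base using (if_then_else_; _∧_)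
open import Data.Product.Base using (_×_; _,_; ∃; proj₁; proj₂)
open import Data.Refinement.Base using (Refinement-syntax; value)
open import Data.Vec.Base as Vec using (Vec; replicate; tabulate; zipWith; _[_]%=_; _[_]≔_)
import Data.Vec.Relation.Unary.All as VecAll
open import Function.Bundles using (Func)
open import Level using (0ℓ; _⊔_)
open import Relation.Binary.Bundles using (Setoid)
open import Relation.Binary.Core using (Rel)
import Relation.Binary.Construct.On as On
open import Relation.Binary.PropositionalEquality.Core using (_≡_)
open import Relation.Nullary.Negation.Core using (¬_)

module _ {a ℓ} (G : AbelianGroup a ℓ) where

  open AbelianGroup G
  open RawMonoidDefinitions rawMonoid using () renaming (_×_ to _×ℕ_)

  infixr 8 _·_

  _·_ : ℤ → Carrier → Carrier
  (+ n)    · x = n ×ℕ x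
  -[1+ n ] · x = (suc n ×ℕ x) ⁻¹

  module _ {i ℓᵢ} {I : Setoid i ℓᵢ} (b : Func I setoid) where

    private module I = Setoid I

    linearCombination : List (ℤ × I.Carrier) → Carrier
    linearCombination = foldr (λ (c , k) x → c · Func.to b k ∙ x) ε

    Spanning : Set (i ⊔ a ⊔ ℓ)
    Spanning = ∀ x → ∃ λ cs → x ≈ linearCombination cs

    LinearlyIndependent : Set (i ⊔ ℓᵢ ⊔ ℓ)
    LinearlyIndependent =
      ∀ cs → AllPairs (λ s t → ¬ (proj₂ s I.≈ proj₂ t)) cs →
      linearCombination cs ≈ ε → All (λ s → proj₁ s ≡ 0ℤ) cs

    record IsBasis : Set (i ⊔ ℓᵢ ⊔ a ⊔ ℓ) where
      field
        spanning            : Spanning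
        linearlyIndependent : LinearlyIndependent

module Presentation {g} (Generator : Set g) where

  infixl 7 _⊛_
  infixl 6 _⊕_
  infix  8 ⊝_

  data Term : Set g where
    var  : Generator → Term
    𝟘 𝟙 : Term
    _⊕_ : Term → Term → Term
    _⊛_ : Term → Term → Term
    ⊝_  : Term → Term

  module _ {r} (Relation : Rel Term r) where

    -- The congruence generated by the axioms of commutative rings and the
    -- given relations; it plays the role of the quotient of the polynomial
    -- ring ℤ[Generator] by the ideal of relations.

    infix 4 _∼_

    data _∼_ : Rel Term (g ⊔ r) where
      relation    : ∀ {s t} → Relation s t → s ∼ t
      refl        : ∀ {s} → s ∼ s
      sym         : ∀ {s t} → s ∼ t → t ∼ s
      trans       : ∀ {s t u} → s ∼ t → t ∼ u → s ∼ u
      ⊕-cong      : ∀ {s s′ t t′} → s ∼ s′ → t ∼ t′ → s ⊕ t ∼ s′ ⊕ t′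
      ⊛-cong      : ∀ {s s′ t t′} → s ∼ s′ → t ∼ t′ → s ⊛ t ∼ s′ ⊛ t′
      ⊝-cong      : ∀ {s s′} → s ∼ s′ → ⊝ s ∼ ⊝ s′
      ⊕-assoc     : ∀ s t u → (s ⊕ t) ⊕ u ∼ s ⊕ (t ⊕ u)
      ⊕-comm      : ∀ s t → s ⊕ t ∼ t ⊕ s
      ⊕-identityˡ : ∀ s → 𝟘 ⊕ s ∼ s
      ⊝-inverseˡ  : ∀ s → (⊝ s) ⊕ s ∼ 𝟘
      ⊛-assoc     : ∀ s t u → (s ⊛ t) ⊛ u ∼ s ⊛ (t ⊛ u)
      ⊛-comm      : ∀ s t → s ⊛ t ∼ t ⊛ s
      ⊛-identityˡ : ∀ s → 𝟙 ⊛ s ∼ s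
      distribˡ    : ∀ s t u → s ⊛ (t ⊕ u) ∼ (s ⊛ t) ⊕ (s ⊛ u)

    presentedRing : CommutativeRing g (g ⊔ r)
    presentedRing = record
      { Carrier = Term
      ; _≈_     = _∼_
      ; _+_     = _⊕_
      ; _*_     = _⊛_
      ; -_      = ⊝_
      ; 0#      = 𝟘
      ; 1#      = 𝟙
      ; isCommutativeRing = record
        { isRing = record
          { +-isAbelianGroup = record
            { isGroup = record
              { isMonoid = record
                { isSemigroup = record
                  { isMagma = record
                    { isEquivalence = record { refl = refl ; sym = sym ; trans = trans }
                    ; ∙-cong        = ⊕-cong
                    }
                  ; assoc = ⊕-assoc
                  }
                ; identity = ⊕-identityˡ , λ s → trans (⊕-comm s 𝟘) (⊕-identityˡ s)
                }
              ; inverse = ⊝-inverseˡ , λ s → trans (⊕-comm s (⊝ s)) (⊝-inverseˡ s)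
              ; ⁻¹-cong = ⊝-cong
              }
            ; comm = ⊕-comm
            }
          ; *-cong     = ⊛-cong
          ; *-assoc    = ⊛-assoc
          ; *-identity = ⊛-identityˡ , λ s → trans (⊛-comm s 𝟙) (⊛-identityˡ s)
          ; distrib    = distribˡ , λ s t u →
              trans (⊛-comm (t ⊕ u) s)
                    (trans (distribˡ s t u) (⊕-cong (⊛-comm s t) (⊛-comm s u)))
          }
        ; *-comm = ⊛-comm
        }
      }

data DynkinType : ℕ → Set where
  A  : ∀ n → 1 ℕ.≤ n → DynkinType n
  B  : ∀ n → 2 ℕ.≤ n → DynkinType n
  C  : ∀ n → 2 ℕ.≤ n → DynkinType n
  D  : ∀ n → 4 ℕ.≤ n → DynkinType n
  E₆ : DynkinType 6
  E₇ : DynkinType 7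
  E₈ : DynkinType 8
  F₄ : DynkinType 4
  G₂ : DynkinType 2

-- The nodes of a diagram of rank n are 0 , … , n-1.  Arrows point from the
-- longer to the shorter root.

infix 5 _—_ _⇒_ _⇛_

data Bond : Set where
  _—_ _⇒_ _⇛_ : ℕ → ℕ → Bond

path : ℕ → List Bond
path k = map (λ i → i — suc i) (upTo (k ∸ 1))

bonds : ∀ {n} → DynkinType n → List Bond
bonds (A n _) = path n
bonds (B n _) = path (n ∸ 1) ++ (n ∸ 2 ⇒ n ∸ 1) ∷ []
bonds (C n _) = path (n ∸ 1) ++ (n ∸ 1 ⇒ n ∸ 2) ∷ []
bonds (D n _) = path (n ∸ 1) ++ (n ∸ 3 — n ∸ 1) ∷ []
bonds E₆      = path 5 ++ (2 — 5) ∷ []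
bonds E₇      = path 6 ++ (2 — 6) ∷ []
bonds E₈      = path 7 ++ (2 — 7) ∷ []
bonds F₄      = (0 — 1) ∷ (1 ⇒ 2) ∷ (2 — 3) ∷ []
bonds G₂      = (0 ⇛ 1) ∷ []

-- For i ≠ j the Cartan integer is 2(αᵢ,αⱼ)/(αᵢ,αᵢ): an m-fold bond from a
-- long root αₖ to a short root αₗ contributes -1 at (k , l) and -m at (l , k).

bondEntry : Bond → ℕ → ℕ → ℤ
bondEntry b i j = entry b
  where
  at : ℕ → ℕ → ℤ → ℤ
  at k l c = if (i ≡ᵇ k) ∧ (j ≡ᵇ l) then c else 0ℤ

  entry : Bond → ℤ
  entry (k — l) = at k l (ℤ.- + 1) ℤ.+ at l k (ℤ.- + 1)
  entry (k ⇒ l) = at k l (ℤ.- + 1) ℤ.+ at l k (ℤ.- + 2)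
  entry (k ⇛ l) = at k l (ℤ.- + 1) ℤ.+ at l k (ℤ.- + 3)

module _ {n} (X : DynkinType n) where

  cartan : Fin n → Fin n → ℤ
  cartan i j =
    if toℕ i ≡ᵇ toℕ j
    then + 2
    else foldr ℤ._+_ 0ℤ (map (λ b → bondEntry b (toℕ i) (toℕ j)) (bonds X))

  -- Elements of the root lattice are written in the basis of simple roots.

  simpleRoot : Fin n → Vec ℤ n
  simpleRoot i = replicate n 0ℤ [ i ]≔ 1ℤ

  -- ⟨ v , αᵢ^∨ ⟩
  pairing : Vec ℤ n → Fin n → ℤ
  pairing v i = Vec.foldr′ ℤ._+_ 0ℤ (zipWith ℤ._*_ (tabulate (cartan i)) v)

  -- v ↦ v - ⟨ v , αᵢ^∨ ⟩ αᵢ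
  simpleReflection : Fin n → Vec ℤ n → Vec ℤ n
  simpleReflection i v = v [ i ]%= λ c → c ℤ.- pairing v i

  -- The root system is the orbit of the simple roots under the Weyl group.

  data IsRoot : Vec ℤ n → Set where
    simple  : ∀ i → IsRoot (simpleRoot i)
    reflect : ∀ i {v} → IsRoot v → IsRoot (simpleReflection i v)

  NonNegativeCoefficients : Vec ℤ n → Set
  NonNegativeCoefficients = VecAll.All (0ℤ ℤ.≤_)

  -- The proof component is irrelevant, so equality of positive roots is
  -- equality of their coefficient vectors.

  Φ₊ : Set
  Φ₊ = [ v ∈ Vec ℤ n ∣ IsRoot v × NonNegativeCoefficients v ]

  infix 4 _≤_

  _≤_ : Rel Φ₊ 0ℓ
  α ≤ β = NonNegativeCoefficients (zipWith ℤ._-_ (value β) (value α))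

  -- Incomparability is irreflexive, so the list has no repetitions and
  -- represents a set; lists differing by a permutation represent the same set.

  record Antichain : Set where
    constructor antichain
    field
      elements     : List Φ₊
      incomparable : AllPairs (λ α β → ¬ (α ≤ β) × ¬ (β ≤ α)) elements

  antichainSetoid : Setoid 0ℓ 0ℓ
  antichainSetoid = On.setoid (↭-setoid {A = Φ₊}) Antichain.elements

  open Presentation Φ₊ using (Term; var; _⊛_; presentedRing)

  data MinRelation : Rel Term 0ℓ where
    minˡ : ∀ {α β} → α ≤ β → MinRelation (var α ⊛ var β) (var α)
    minʳ : ∀ {α β} → β ≤ α → MinRelation (var α ⊛ var β) (var β)

  U : CommutativeRing 0ℓ 0ℓ
  U = presentedRing MinRelation

  private module U = CommutativeRing U

  u : Φ₊ → U.Carrier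
  u = var

  monomial : Func antichainSetoid U.setoid
  monomial = record
    { to   = λ p → foldr U._*_ U.1# (map u (Antichain.elements p))
    ; cong = λ p↭q → SetoidPerm.foldr-commMonoid U.setoid U.*-isCommutativeMonoid
               (↭⇒↭ₛ′ U.isEquivalence (map⁺ u p↭q))
    }

{-# OPTIONS --safe #-}

-- For a finite set q of positive roots, u_α ↦ [some β ∈ q has β ≤ α] defines a
-- ring homomorphism U → ℤ, because the indicator function of an up-set is
-- multiplicative on comparable pairs.  On antichains it sends u_p to
-- [p ⊑ q], where p ⊑ q means that p lies in the up-set generated by q.  Since ⊑
-- is a partial order on antichains, the matrix of these values is
-- unitriangular, whence linear independence.  For spanning, the span of the u_p
-- is stable under multiplication by each u_α: if some β ∈ p has β ≤ α then
-- u_α u_p = u_p, and otherwise u_α u_p = u_p′ with p′ obtained from p by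
-- removing the elements above α and adding α.

module Submission where

open import Defs
open import Algebra.Bundles using (AbelianGroup; CommutativeRing)
import Algebra.Definitions.RawMonoid as RawMonoidDefinitions
import Algebra.Properties.AbelianGroup as AbelianGroupProperties
import Algebra.Properties.CommutativeSemigroup as CommutativeSemigroupProperties
import Algebra.Properties.Ring as RingProperties
open import Data.Bool.Base using (Bool; true; false; if_then_else_; _∧_)
open import Data.Integer.Base as ℤ using (ℤ; +_; -[1+_]; 0ℤ; 1ℤ)
import Data.Integer.Properties as ℤₚ
open import Data.List.Base using (List; []; _∷_; _++_; foldr; map; filter; length)
open import Data.List.Properties using (map-cong)
open import Data.List.Membership.Propositional using (_∈_; find; lose)
open import Data.List.Relation.Binary.Permutation.Propositional
  using (_↭_; ↭-refl; ↭-sym; ↭-trans; ↭-prep; ↭-swap; ↭⇒↭ₛ)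
open import Data.List.Relation.Binary.Permutation.Propositional.Properties
  using (All-resp-↭; ∈-resp-↭; ↭-length; map⁺)
open import Data.List.Relation.Binary.BagAndSetEquality using (∼bag⇒↭)
open import Data.List.Membership.Propositional.Properties.WithK using (unique∧set⇒bag)
import Data.List.Relation.Binary.Permutation.Setoid.Properties as SetoidPerm
open import Data.List.Relation.Unary.All as All using (All; []; _∷_; all?)
import Data.List.Relation.Unary.All.Properties as Allₚ
open import Data.List.Relation.Unary.AllPairs as AllPairs using (AllPairs; []; _∷_)
import Data.List.Relation.Unary.AllPairs.Properties as AllPairsₚ
open import Data.List.Relation.Unary.Any as Any using (Any; here; there; any?)
open import Data.List.Relation.Unary.Unique.Propositional using (Unique)
open import Data.Nat.Base using (ℕ; zero; suc)
import Data.Nat.Properties as ℕₚ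
open import Data.Product.Base using (_×_; _,_; ∃; ∃₂; proj₁; proj₂)
open import Data.Refinement.Base using (value)
open import Data.Refinement.Properties using (value-injective)
open import Data.Vec.Base using (Vec; []; _∷_; zipWith)
open import Data.Vec.Relation.Binary.Pointwise.Inductive as Pointwise
  using (Pointwise; []; _∷_; Pointwise-≡⇒≡)
open import Data.Vec.Relation.Unary.All as VecAll using ([]; _∷_)
open import Function.Base using (_∘_)
open import Function.Bundles using (Func; mk⇔)
open import Level using (0ℓ; _⊔_)
open import Relation.Binary.Bundles using (Setoid; Poset)
open import Relation.Binary.Core using (Rel)
open import Relation.Binary.Definitions using (Decidable; Transitive)
open import Relation.Binary.PropositionalEquality
  using (_≡_; refl; sym; trans; cong; cong₂; subst; module ≡-Reasoning)
import Relation.Binary.PropositionalEquality.Properties as ≡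
open import Relation.Nullary using (¬_; Dec; yes; no; does; contradiction)
open import Relation.Nullary.Decidable using (¬?)

-- Linear combinations

module _ {a ℓ} (G : AbelianGroup a ℓ) where

  open AbelianGroup G
    renaming (refl to ≈-refl; sym to ≈-sym; trans to ≈-trans)
  open AbelianGroupProperties G using (ε⁻¹≈ε; ⁻¹-involutive; ⁻¹-∙-comm)

  -‿distribˡ-· : ∀ c x → _·_ G (ℤ.- c) x ≈ (_·_ G c x) ⁻¹
  -‿distribˡ-· (+ zero)  x = ≈-sym ε⁻¹≈ε
  -‿distribˡ-· (+ suc n) x = ≈-refl
  -‿distribˡ-· -[1+ n ]  x = ≈-sym (⁻¹-involutive _)

  record IsSubgroup {p} (P : Carrier → Set p) : Set (a ⊔ ℓ ⊔ p) where
    field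
      respects  : ∀ {x y} → x ≈ y → P x → P y
      ε-closed  : P ε
      ∙-closed  : ∀ {x y} → P x → P y → P (x ∙ y)
      ⁻¹-closed : ∀ {x} → P x → P (x ⁻¹)

    ·-closed : ∀ c {x} → P x → P (_·_ G c x)
    ·-closed (+ n)    px = ×-closed n
      where
      open RawMonoidDefinitions rawMonoid using () renaming (_×_ to _×ℕ_)
      ×-closed : ∀ n → P (n ×ℕ _)
      ×-closed zero    = ε-closed
      ×-closed (suc n) = ∙-closed px (×-closed n)
    ·-closed -[1+ n ] px = ⁻¹-closed (·-closed (+ suc n) px)

  module _ {i ℓᵢ} {I : Setoid i ℓᵢ} (b : Func I setoid) where

    private module I = Setoid I

    InSpan : Carrier → Set (i ⊔ ℓ)
    InSpan x = ∃ λ cs → x ≈ linearCombination G b cs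

    InSpan-isSubgroup : IsSubgroup InSpan
    InSpan-isSubgroup = record
      { respects  = λ x≈y (cs , x≈) → cs , ≈-trans (≈-sym x≈y) x≈
      ; ε-closed  = [] , ≈-refl
      ; ∙-closed  = λ (cs , x≈) (ds , y≈) →
          cs ++ ds , ≈-trans (∙-cong x≈ y≈) (≈-sym (lc-++ cs ds))
      ; ⁻¹-closed = λ (cs , x≈) →
          map negate cs , ≈-trans (⁻¹-cong x≈) (≈-sym (lc-negate cs))
      }
      where
      negate : ℤ × I.Carrier → ℤ × I.Carrier
      negate (c , k) = ℤ.- c , k

      lc-++ : ∀ cs ds → linearCombination G b (cs ++ ds) ≈
                        linearCombination G b cs ∙ linearCombination G b ds
      lc-++ []       ds = ≈-sym (identityˡ _)
      lc-++ (_ ∷ cs) ds = ≈-trans (∙-congˡ (lc-++ cs ds)) (≈-sym (assoc _ _ _))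

      lc-negate : ∀ cs → linearCombination G b (map negate cs) ≈
                         (linearCombination G b cs) ⁻¹
      lc-negate []             = ≈-sym ε⁻¹≈ε
      lc-negate ((c , k) ∷ cs) =
        ≈-trans (∙-cong (-‿distribˡ-· c _) (lc-negate cs)) (⁻¹-∙-comm _ _)

    basis-InSpan : ∀ k → InSpan (Func.to b k)
    basis-InSpan k =
      (1ℤ , k) ∷ [] , ≈-sym (≈-trans (identityʳ _) (identityʳ _))

    -- An induction principle: an additive property of all elements of the span needs checking on
    -- the family `b` alone. It is applied below to the property that the product with a fixed term
    -- stays in the span.
    InSpan-least : ∀ {p} {P : Carrier → Set p} → IsSubgroup P →
                   (∀ k → P (Func.to b k)) → ∀ {x} → InSpan x → P x
    InSpan-least {P = P} isSubgroup basis (cs , x≈) = respects (≈-sym x≈) (lc-closed cs)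
      where
      open IsSubgroup isSubgroup
      lc-closed : ∀ cs → P (linearCombination G b cs)
      lc-closed []             = ε-closed
      lc-closed ((c , k) ∷ cs) = ∙-closed (·-closed c (basis k)) (lc-closed cs)

-- Evaluation of a presented ring in the integers

module Evaluation {g} {Generator : Set g} (χ : Generator → ℤ) where

  open Presentation Generator renaming (refl to ∼-refl; sym to ∼-sym; trans to ∼-trans)

  ⟦_⟧ : Term → ℤ
  ⟦ var x ⟧ = χ x
  ⟦ 𝟘 ⟧     = 0ℤ
  ⟦ 𝟙 ⟧     = 1ℤ
  ⟦ s ⊕ t ⟧ = ⟦ s ⟧ ℤ.+ ⟦ t ⟧
  ⟦ s ⊛ t ⟧ = ⟦ s ⟧ ℤ.* ⟦ t ⟧
  ⟦ ⊝ s ⟧   = ℤ.- ⟦ s ⟧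

  module _ {r} {Relation : Rel Term r}
           (⟦⟧-relation : ∀ {s t} → Relation s t → ⟦ s ⟧ ≡ ⟦ t ⟧) where

    -- The universal property of the presentation: the ring axioms hold in ℤ, so only the defining
    -- relations have to be verified for an assignment `χ`.
    ⟦⟧-cong : ∀ {s t} → _∼_ Relation s t → ⟦ s ⟧ ≡ ⟦ t ⟧
    ⟦⟧-cong (relation s∼t)     = ⟦⟧-relation s∼t
    ⟦⟧-cong ∼-refl             = refl
    ⟦⟧-cong (∼-sym p)          = sym (⟦⟧-cong p)
    ⟦⟧-cong (∼-trans p q)      = trans (⟦⟧-cong p) (⟦⟧-cong q)
    ⟦⟧-cong (⊕-cong p q)       = cong₂ ℤ._+_ (⟦⟧-cong p) (⟦⟧-cong q)
    ⟦⟧-cong (⊛-cong p q)       = cong₂ ℤ._*_ (⟦⟧-cong p) (⟦⟧-cong q)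
    ⟦⟧-cong (⊝-cong p)         = cong ℤ.-_ (⟦⟧-cong p)
    ⟦⟧-cong (⊕-assoc s t u)    = ℤₚ.+-assoc ⟦ s ⟧ ⟦ t ⟧ ⟦ u ⟧
    ⟦⟧-cong (⊕-comm s t)       = ℤₚ.+-comm ⟦ s ⟧ ⟦ t ⟧
    ⟦⟧-cong (⊕-identityˡ s)    = ℤₚ.+-identityˡ ⟦ s ⟧
    ⟦⟧-cong (⊝-inverseˡ s)     = ℤₚ.+-inverseˡ ⟦ s ⟧
    ⟦⟧-cong (⊛-assoc s t u)    = ℤₚ.*-assoc ⟦ s ⟧ ⟦ t ⟧ ⟦ u ⟧
    ⟦⟧-cong (⊛-comm s t)       = ℤₚ.*-comm ⟦ s ⟧ ⟦ t ⟧
    ⟦⟧-cong (⊛-identityˡ s)    = ℤₚ.*-identityˡ ⟦ s ⟧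
    ⟦⟧-cong (distribˡ s t u)   = ℤₚ.*-distribˡ-+ ⟦ s ⟧ ⟦ t ⟧ ⟦ u ⟧

  module _ {r} (Relation : Rel Term r) where

    private G = CommutativeRing.+-abelianGroup (presentedRing Relation)
    open AbelianGroup G using (rawMonoid; setoid)
    open RawMonoidDefinitions rawMonoid using () renaming (_×_ to _×ℕ_)

    ⟦×⟧ : ∀ n t → ⟦ n ×ℕ t ⟧ ≡ + n ℤ.* ⟦ t ⟧
    ⟦×⟧ zero    t = refl
    ⟦×⟧ (suc n) t = trans (cong (ℤ._+_ ⟦ t ⟧) (⟦×⟧ n t)) (sym (ℤₚ.suc-* (+ n) ⟦ t ⟧))

    ⟦·⟧ : ∀ c t → ⟦ _·_ G c t ⟧ ≡ c ℤ.* ⟦ t ⟧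
    ⟦·⟧ (+ n)    t = ⟦×⟧ n t
    ⟦·⟧ -[1+ n ] t =
      trans (cong ℤ.-_ (⟦×⟧ (suc n) t)) (ℤₚ.neg-distribˡ-* (+ suc n) ⟦ t ⟧)

    ⟦linearCombination⟧ :
      ∀ {i ℓᵢ} {I : Setoid i ℓᵢ} (b : Func I setoid) cs →
      ⟦ linearCombination G b cs ⟧ ≡
      foldr ℤ._+_ 0ℤ (map (λ (c , k) → c ℤ.* ⟦ Func.to b k ⟧) cs)
    ⟦linearCombination⟧ b []             = refl
    ⟦linearCombination⟧ b ((c , k) ∷ cs) =
      cong₂ ℤ._+_ (⟦·⟧ c _) (⟦linearCombination⟧ b cs)

-- Linear independence of the rows of a zeta matrix

𝟏 : Bool → ℤ
𝟏 b = if b then 1ℤ else 0ℤ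

𝟏-∧ : ∀ a b → 𝟏 a ℤ.* 𝟏 b ≡ 𝟏 (a ∧ b)
𝟏-∧ true  true  = refl
𝟏-∧ true  false = refl
𝟏-∧ false b     = refl

𝟏-absorb : ∀ {A B : Set} (a? : Dec A) (b? : Dec B) → (A → B) →
           𝟏 (does a?) ℤ.* 𝟏 (does b?) ≡ 𝟏 (does a?)
𝟏-absorb (yes a) (yes b) a⇒b = refl
𝟏-absorb (yes a) (no ¬b) a⇒b = contradiction (a⇒b a) ¬b
𝟏-absorb (no ¬a) b?      a⇒b = refl

sum-↭ : ∀ {A : Set} (f : A → ℤ) {xs ys} → xs ↭ ys →
        foldr ℤ._+_ 0ℤ (map f xs) ≡ foldr ℤ._+_ 0ℤ (map f ys)
sum-↭ f p = SetoidPerm.foldr-commMonoid (≡.setoid ℤ) ℤₚ.+-0-isCommutativeMonoid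
  (↭⇒↭ₛ (map⁺ f p))

module ZetaMatrix {c ℓ} (P : Poset 0ℓ c ℓ) (_⊑?_ : Decidable (Poset._≤_ P)) where

  open Poset P using (Carrier; _≈_) renaming (_≤_ to _⊑_)
  private module P = Poset P

  zetaTerm : Carrier → ℤ × Carrier → ℤ
  zetaTerm q (c , k) = c ℤ.* 𝟏 (does (k ⊑? q))

  zetaSum : Carrier → List (ℤ × Carrier) → ℤ
  zetaSum q cs = foldr ℤ._+_ 0ℤ (map (zetaTerm q) cs)

  Distinct : Rel (ℤ × Carrier) c
  Distinct s t = ¬ (proj₂ s ≈ proj₂ t)

  Distinct-↭ : ∀ {cs ds} → cs ↭ ds → AllPairs Distinct cs → AllPairs Distinct ds
  Distinct-↭ p = SetoidPerm.AllPairs-resp-↭ (≡.setoid _) (_∘ P.Eq.sym)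
    ((λ { refl d → d }) , (λ { refl d → d })) (↭⇒↭ₛ p)

  -- The head is compared with the minimal entry `t` of the tail. If it lies below `t`, it takes
  -- over, since anything below it would be below `t`; otherwise `t` remains minimal.
  extractMinimal : ∀ s cs → AllPairs Distinct (s ∷ cs) →
    ∃₂ λ t ds → s ∷ cs ↭ t ∷ ds × All (λ r → ¬ (proj₂ r ⊑ proj₂ t)) ds
  extractMinimal s []        _ = s , [] , ↭-refl , []
  extractMinimal s (s′ ∷ cs) (s≉ ∷ distinct)
    with extractMinimal s′ cs distinct
  ... | t , ds , p , minimal with proj₂ s ⊑? proj₂ t
  ...   | yes s⊑t = s , t ∷ ds , ↭-prep s p
                  -- With `t⊑s`, antisymmetry would make the keys of `s` and `t` equal, although `t`
                  -- is an entry of the tail and hence distinct from `s`.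
                  , (λ t⊑s → All.head (All-resp-↭ p s≉) (P.antisym s⊑t t⊑s))
                  ∷ All.map (λ r⋢t r⊑s → r⋢t (P.trans r⊑s s⊑t)) minimal
  ...   | no s⋢t  = t , s ∷ ds , ↭-trans (↭-prep s p) (↭-swap s t ↭-refl)
                  , s⋢t ∷ minimal

  zetaSum-vanishes : ∀ q {cs} → All (λ r → ¬ (proj₂ r ⊑ q)) cs → zetaSum q cs ≡ 0ℤ
  zetaSum-vanishes q [] = refl
  zetaSum-vanishes q {(c , k) ∷ cs} (k⋢q ∷ rest) with k ⊑? q
  ... | yes k⊑q = contradiction k⊑q k⋢q
  ... | no  _   = cong₂ ℤ._+_ (ℤₚ.*-zeroʳ c) (zetaSum-vanishes q rest)

  -- At the column of a minimal key only the diagonal entry survives.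
  zetaSum-minimal : ∀ c k {cs} → All (λ r → ¬ (proj₂ r ⊑ k)) cs →
                    zetaSum k ((c , k) ∷ cs) ≡ c
  zetaSum-minimal c k minimal with k ⊑? k
  ... | yes _   = trans (cong₂ ℤ._+_ (ℤₚ.*-identityʳ c) (zetaSum-vanishes k minimal))
                        (ℤₚ.+-identityʳ c)
  ... | no  k⋢k = contradiction P.refl k⋢k

  -- Triangular elimination: the column of a minimal key isolates its coefficient, which therefore
  -- vanishes, and the remaining shorter combination still satisfies all equations.
  zeta-independent : ∀ cs → AllPairs Distinct cs → (∀ q → zetaSum q cs ≡ 0ℤ) →
                     All (λ s → proj₁ s ≡ 0ℤ) cs
  zeta-independent cs = go (length cs) cs refl
    where
    -- The recursion runs on the length because the list `ds` left after extraction is a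
    -- rearrangement, not a sublist visible to the termination checker.
    go : ∀ n cs → length cs ≡ n → AllPairs Distinct cs →
         (∀ q → zetaSum q cs ≡ 0ℤ) → All (λ s → proj₁ s ≡ 0ℤ) cs
    go n       []       _  _        _    = []
    go (suc n) (s ∷ cs) eq distinct vanish with extractMinimal s cs distinct
    ... | (c , k) , ds , p , minimal =
      All-resp-↭ (↭-sym p)
        (c≡0 ∷ go n ds length-ds (AllPairs.tail (Distinct-↭ p distinct)) vanish′)
      where
      length-ds : length ds ≡ n
      length-ds = ℕₚ.suc-injective (trans (sym (↭-length p)) eq)

      vanish-↭ : ∀ q → zetaSum q ((c , k) ∷ ds) ≡ 0ℤ
      vanish-↭ q = trans (sym (sum-↭ (zetaTerm q) p)) (vanish q)

      c≡0 : c ≡ 0ℤ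
      c≡0 = trans (sym (zetaSum-minimal c k minimal)) (vanish-↭ k)

      vanish′ : ∀ q → zetaSum q ds ≡ 0ℤ
      vanish′ q = begin
        -- A term with coefficient `0ℤ` computes to `0ℤ`, so it can be put in front and then
        -- exchanged for the term with coefficient `c`.
        zetaSum q ds                         ≡⟨ ℤₚ.+-identityˡ _ ⟨
        zetaTerm q (0ℤ , k) ℤ.+ zetaSum q ds ≡⟨ cong (λ z → zetaTerm q (z , k) ℤ.+ zetaSum q ds) c≡0 ⟨
        zetaTerm q (c , k) ℤ.+ zetaSum q ds  ≡⟨ vanish-↭ q ⟩
        0ℤ                                   ∎
        where open ≡-Reasoning

-- Positive roots and antichains

-- In coordinatewise form the root order inherits transitivity and antisymmetry directly from ℤ.
0≤w-v⇒v≤w : ∀ {n} {v w : Vec ℤ n} → VecAll.All (0ℤ ℤ.≤_) (zipWith ℤ._-_ w v) →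
            Pointwise ℤ._≤_ v w
0≤w-v⇒v≤w {v = []}    {[]}    []       = []
0≤w-v⇒v≤w {v = _ ∷ _} {_ ∷ _} (p ∷ ps) = ℤₚ.0≤i-j⇒j≤i p ∷ 0≤w-v⇒v≤w ps

v≤w⇒0≤w-v : ∀ {n} {v w : Vec ℤ n} → Pointwise ℤ._≤_ v w →
            VecAll.All (0ℤ ℤ.≤_) (zipWith ℤ._-_ w v)
v≤w⇒0≤w-v []       = []
v≤w⇒0≤w-v (p ∷ ps) = ℤₚ.i≤j⇒0≤j-i p ∷ v≤w⇒0≤w-v ps

Pointwise-≤-antisym : ∀ {n} {v w : Vec ℤ n} →
  Pointwise ℤ._≤_ v w → Pointwise ℤ._≤_ w v → Pointwise _≡_ v w
Pointwise-≤-antisym []       []       = []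
Pointwise-≤-antisym (p ∷ ps) (q ∷ qs) = ℤₚ.≤-antisym p q ∷ Pointwise-≤-antisym ps qs

module _ {n} (X : DynkinType n) where

  private
    infix 4 _≼_
    _≼_ : Rel (Φ₊ X) 0ℓ
    _≼_ = _≤_ X

  ≼-refl : ∀ α → α ≼ α
  ≼-refl α = v≤w⇒0≤w-v (Pointwise.refl ℤₚ.≤-refl {x = value α})

  ≼-trans : ∀ α β γ → α ≼ β → β ≼ γ → α ≼ γ
  ≼-trans α β γ α≼β β≼γ =
    v≤w⇒0≤w-v (Pointwise.trans ℤₚ.≤-trans
      (0≤w-v⇒v≤w {v = value α} {value β} α≼β) (0≤w-v⇒v≤w {v = value β} {value γ} β≼γ))

  ≼-antisym : ∀ α β → α ≼ β → β ≼ α → α ≡ β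
  ≼-antisym α β α≼β β≼α = value-injective (Pointwise-≡⇒≡ (Pointwise-≤-antisym
    (0≤w-v⇒v≤w {v = value α} {value β} α≼β) (0≤w-v⇒v≤w {v = value β} {value α} β≼α)))

  _≼?_ : ∀ α β → Dec (α ≼ β)
  α ≼? β = VecAll.all? (0ℤ ℤₚ.≤?_) _

  Incomparable : Rel (Φ₊ X) 0ℓ
  Incomparable α β = ¬ (α ≼ β) × ¬ (β ≼ α)

  -- Up-sets and the order on antichains

  open Antichain

  Above : List (Φ₊ X) → Φ₊ X → Set
  Above q α = Any (_≼ α) q

  above? : ∀ q α → Dec (Above q α)
  above? q α = any? (_≼? α) q

  above-upward : ∀ {q} α β → α ≼ β → Above q α → Above q β
  above-upward α β α≼β = Any.map (λ {γ} γ≼α → ≼-trans γ α β γ≼α α≼β)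

  infix 4 _⊑_ _⊑?_

  _⊑_ : Rel (Antichain X) 0ℓ
  p ⊑ q = All (Above (elements q)) (elements p)

  _⊑?_ : Decidable _⊑_
  p ⊑? q = all? (above? (elements q)) (elements p)

  ⊑-reflexive : ∀ {p q} → elements p ↭ elements q → p ⊑ q
  ⊑-reflexive p↭q = All.tabulate λ {α} α∈p → lose (∈-resp-↭ p↭q α∈p) (≼-refl α)

  ⊑-trans : Transitive _⊑_
  ⊑-trans p⊑q q⊑r = All.map (λ {α} above →
    let β , β∈q , β≼α = find above in above-upward β α β≼α (All.lookup q⊑r β∈q)) p⊑q

  antichain-unique : ∀ {ps} → AllPairs Incomparable ps → Unique ps
  antichain-unique = AllPairs.map λ { {α} (α⋠β , _) refl → α⋠β (≼-refl α) }

  comparable⇒≡ : ∀ {ps α β} → AllPairs Incomparable ps → α ∈ ps → β ∈ ps → α ≼ β → α ≡ β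
  comparable⇒≡ _        (here refl) (here refl) _   = refl
  comparable⇒≡ (i ∷ _)  (here refl) (there β∈)  α≼β = contradiction α≼β (proj₁ (All.lookup i β∈))
  comparable⇒≡ (i ∷ _)  (there α∈)  (here refl) α≼β = contradiction α≼β (proj₂ (All.lookup i α∈))
  comparable⇒≡ (_ ∷ is) (there α∈)  (there β∈)  α≼β = comparable⇒≡ is α∈ β∈ α≼β

  -- Going from `p` to `q` and back gives a chain `γ ≼ β ≼ α` with both ends in `p`. Its ends
  -- coincide because `p` is an antichain, so `β` is squeezed to `α`.
  ⊑-antisym-∈ : ∀ p q → p ⊑ q → q ⊑ p → ∀ {α} → α ∈ elements p → α ∈ elements q
  ⊑-antisym-∈ p q p⊑q q⊑p {α} α∈p
    with β , β∈q , β≼α ← find (All.lookup p⊑q α∈p)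
    with γ , γ∈p , γ≼β ← find (All.lookup q⊑p β∈q)
    with refl ← comparable⇒≡ (incomparable p) γ∈p α∈p (≼-trans γ β α γ≼β β≼α)
    = subst (_∈ elements q) (≼-antisym β α β≼α γ≼β) β∈q

  ⊑-antisym : ∀ {p q} → p ⊑ q → q ⊑ p → elements p ↭ elements q
  ⊑-antisym {p} {q} p⊑q q⊑p = ∼bag⇒↭ (unique∧set⇒bag
    (antichain-unique (incomparable p)) (antichain-unique (incomparable q))
    (mk⇔ (⊑-antisym-∈ p q p⊑q q⊑p) (⊑-antisym-∈ q p q⊑p p⊑q)))

  antichainPoset : Poset 0ℓ 0ℓ 0ℓ
  antichainPoset = record
    { Carrier        = Antichain X
    ; _≈_            = Setoid._≈_ (antichainSetoid X)
    ; _≤_            = _⊑_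
    ; isPartialOrder = record
      { isPreorder = record
        { isEquivalence = Setoid.isEquivalence (antichainSetoid X)
        ; reflexive     = λ {p} {q} → ⊑-reflexive {p} {q}
        ; trans         = λ {p} {q} {r} → ⊑-trans {p} {q} {r}
        }
      ; antisym = λ {p} {q} → ⊑-antisym {p} {q}
      }
    }

  open ZetaMatrix antichainPoset _⊑?_ using (zetaSum; zeta-independent)
  open Presentation (Φ₊ X) using (Term; var; 𝟘; 𝟙; _⊕_; _⊛_; ⊝_; relation)

  private
    module U = CommutativeRing (U X)
    G = U.+-abelianGroup
    Span = InSpan G (monomial X)
    module Span = IsSubgroup (InSpan-isSubgroup G (monomial X))
  open CommutativeSemigroupProperties U.*-commutativeSemigroup using (x∙yz≈y∙xz)

  -- Linear independence through indicators of up-sets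

  module _ (q : Antichain X) where

    open Evaluation (λ α → 𝟏 (does (above? (elements q) α)))

    ⟦⟧-min : ∀ {s t} → MinRelation X s t → ⟦ s ⟧ ≡ ⟦ t ⟧
    ⟦⟧-min (minˡ {α} {β} α≼β) =
      𝟏-absorb (above? (elements q) α) (above? (elements q) β) (above-upward α β α≼β)
    ⟦⟧-min (minʳ {α} {β} β≼α) = trans (ℤₚ.*-comm ⟦ var α ⟧ ⟦ var β ⟧)
      (𝟏-absorb (above? (elements q) β) (above? (elements q) α) (above-upward β α β≼α))

    ⟦monomial⟧ : ∀ p → ⟦ Func.to (monomial X) p ⟧ ≡ 𝟏 (does (p ⊑? q))
    ⟦monomial⟧ p = go (elements p)
      where
      go : ∀ ps → ⟦ foldr _⊛_ 𝟙 (map var ps) ⟧ ≡ 𝟏 (does (all? (above? (elements q)) ps))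
      go []       = refl
      go (α ∷ ps) = trans (cong (ℤ._*_ ⟦ var α ⟧) (go ps))
                          (𝟏-∧ (does (above? (elements q) α)) _)

    ⟦linearCombination-monomial⟧ : ∀ cs →
      ⟦ linearCombination G (monomial X) cs ⟧ ≡ zetaSum q cs
    ⟦linearCombination-monomial⟧ cs =
      trans (⟦linearCombination⟧ (MinRelation X) (monomial X) cs)
            (cong (foldr ℤ._+_ 0ℤ) (map-cong (λ (c , p) → cong (c ℤ.*_) (⟦monomial⟧ p)) cs))

  -- Each antichain `q` gives a homomorphism to ℤ. Applied to a vanishing combination, these yield
  -- one zeta equation per `q`.
  monomial-independent : LinearlyIndependent G (monomial X)
  monomial-independent cs distinct lc≈0 = zeta-independent cs distinct λ q →
    trans (sym (⟦linearCombination-monomial⟧ q cs))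
          (Evaluation.⟦⟧-cong _ (⟦⟧-min q) lc≈0)

  -- Spanning through multiplication by generators

  product : List (Φ₊ X) → Term
  product ps = foldr _⊛_ 𝟙 (map var ps)

  -- The factor `var α` is moved inward until it meets a root below `α`, which absorbs it.
  absorb-above : ∀ α ps → Above ps α → var α ⊛ product ps U.≈ product ps
  absorb-above α (β ∷ ps) (here β≼α)  =
    U.trans (U.sym (U.*-assoc _ _ _)) (U.*-congʳ (relation (minʳ β≼α)))
  absorb-above α (β ∷ ps) (there above) =
    U.trans (x∙yz≈y∙xz _ _ _) (U.*-congˡ (absorb-above α ps above))

  withoutAbove : Φ₊ X → List (Φ₊ X) → List (Φ₊ X)
  withoutAbove α = filter (λ β → ¬? (α ≼? β))

  -- As long as the factor `var α` is present, it can be expanded to `var α ⊛ var β` for each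
  -- discarded `β` above `α`.
  product-withoutAbove : ∀ α ps →
    var α ⊛ product (withoutAbove α ps) U.≈ var α ⊛ product ps
  product-withoutAbove α []       = U.refl
  product-withoutAbove α (β ∷ ps) with α ≼? β
  ... | yes α≼β = U.trans (product-withoutAbove α ps)
    (U.trans (U.*-congʳ (U.sym (relation (minˡ α≼β)))) (U.*-assoc _ _ _))
  ... | no  _   = U.trans (x∙yz≈y∙xz _ _ _)
    (U.trans (U.*-congˡ (product-withoutAbove α ps)) (x∙yz≈y∙xz _ _ _))

  var-⊛-monomial : ∀ α p → ∃ λ q → var α ⊛ Func.to (monomial X) p U.≈ Func.to (monomial X) q
  var-⊛-monomial α p with above? (elements p) α
  ... | yes above = p , absorb-above α (elements p) above
  ... | no  ¬above = antichain (α ∷ withoutAbove α (elements p))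
      -- The filter excludes roots above `α`, and `¬above` excludes roots below it; together they
      -- make `α` incomparable to all that remain.
      (All.zip (Allₚ.all-filter _ (elements p) , Allₚ.filter⁺ _ (Allₚ.¬Any⇒All¬ _ ¬above))
        ∷ AllPairsₚ.filter⁺ _ (incomparable p))
    , U.sym (product-withoutAbove α (elements p))

  -- Multiplication by `s` is additive, so the preimage of the span under it is a subgroup.
  ⊛-isSubgroup : ∀ s → IsSubgroup G (λ t → Span (s ⊛ t))
  ⊛-isSubgroup s = record
    { respects  = λ t∼t′ → Span.respects (U.*-congˡ t∼t′)
    ; ε-closed  = Span.respects (U.sym (U.zeroʳ s)) Span.ε-closed
    ; ∙-closed  = λ a b → Span.respects (U.sym (U.distribˡ s _ _)) (Span.∙-closed a b)
    ; ⁻¹-closed = λ a → Span.respects (RingProperties.-‿distribʳ-* U.ring s _) (Span.⁻¹-closed a)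
    }

  -- The span is an ideal, by induction on the multiplier. The argument `t` stays general because a
  -- product `s ⊛ r` acts by `r` first and then by `s`.
  ⊛-InSpan : ∀ s {t} → Span t → Span (s ⊛ t)
  ⊛-InSpan (var α) = InSpan-least G (monomial X) (⊛-isSubgroup (var α)) λ p →
    let q , eq = var-⊛-monomial α p in Span.respects (U.sym eq) (basis-InSpan G (monomial X) q)
  ⊛-InSpan 𝟘       _ = Span.respects (U.sym (U.zeroˡ _)) Span.ε-closed
  ⊛-InSpan 𝟙       t = Span.respects (U.sym (U.*-identityˡ _)) t
  ⊛-InSpan (s ⊕ r) t = Span.respects (U.sym (U.distribʳ _ s r))
    (Span.∙-closed (⊛-InSpan s t) (⊛-InSpan r t))
  ⊛-InSpan (s ⊛ r) t = Span.respects (U.sym (U.*-assoc s r _)) (⊛-InSpan s (⊛-InSpan r t))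
  ⊛-InSpan (⊝ s)   t = Span.respects (RingProperties.-‿distribˡ-* U.ring s _)
    (Span.⁻¹-closed (⊛-InSpan s t))

  monomial-spanning : Spanning G (monomial X)
  -- The unit is the monomial of the empty antichain, and an ideal containing it is the whole ring.
  monomial-spanning s = Span.respects (U.*-identityʳ s)
    (⊛-InSpan s (basis-InSpan G (monomial X) (antichain [] [])))

proposition5p2 : ∀ {n : ℕ} (X : DynkinType n) →
    IsBasis (CommutativeRing.+-abelianGroup (U X)) (monomial X)
proposition5p2 X = record
  { spanning            = monomial-spanning X
  ; linearlyIndependent = monomial-independent X
  }
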